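{- Let $J,A$ be sets. There is a structurally recursive function assigning to every $\vec u:\mathsf{List}(J)$ and every $\mathfrak a:\mathcal{E}(\mathbb{N},J,A)$ an element $\mathsf{norm}_{\vec u}(\mathfrak a):\mathcal{B}(J,A)$ such that, for all $\vec u:\mathsf{List}(J)$ and $\mathfrak a:\mathcal{E}(\mathbb{N},J,A)$, the relation $\vec u\Vdash\mathfrak a\Downarrow\mathsf{norm}_{\vec u}(\mathfrak a)$ holds.
   Context: Setting: constructive metatheory with function extensionality. $\mathsf{List}(J)$: finite lists; $[\,]$ the empty list; $j::\vec v$ has head $j$ and tail $\vec v$; $\vec u\cdot j$ is $\vec u$ with $j$ appended at the end. Escardó dialogues. For sets $I,J,A$, $\mathcal{E}(I,J,A)$ is the inductive set with constructors $\mathsf{ret}(a)$ for $a:A$, and $\mathsf{query}(i,\mathfrak a)$ for $i:I$ and $\mathfrak a:J\to\mathcal{E}(I,J,A)$. Brouwerian dialogues. For sets $J,A$, $\mathcal{B}(J,A)$ is the inductive set with constructors $\mathsf{spit}(a)$ for $a:A$, and $\mathsf{bite}(\mathbf a)$ for $\mathbf a:J\to\mathcal{B}(J,A)$. Normalization relations. Two relations are defined by mutual induction: $\vec u\Vdash\mathfrak a\Downarrow\mathbf a$ (with $\vec u:\mathsf{List}(J)$, $\mathfrak a:\mathcal{E}(\mathbb{N},J,A)$, $\mathbf a:\mathcal{B}(J,A)$), and $\vec u\Vdash\langle i,\mathfrak a\rangle;\vec v\Downarrow\mathbf a$ (with $\vec u,\vec v:\mathsf{List}(J)$, $i:\mathbb{N}$,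 $\mathfrak a:J\to\mathcal{E}(\mathbb{N},J,A)$, $\mathbf a:\mathcal{B}(J,A)$), generated by the rules: 1. $\vec u\Vdash\mathsf{ret}(a)\Downarrow\mathsf{spit}(a)$. 2. If $\vec u\Vdash\langle i,\mathfrak a\rangle;\vec u\Downarrow\mathbf a$, then $\vec u\Vdash\mathsf{query}(i,\mathfrak a)\Downarrow\mathbf a$. 3. If $\vec u\Vdash\mathfrak a(j)\Downarrow\mathbf a$, then $\vec u\Vdash\langle 0,\mathfrak a\rangle;(j::\vec v)\Downarrow\mathbf a$. 4. If $\vec u\Vdash\langle i,\mathfrak a\rangle;\vec v\Downarrow\mathbf a$, then $\vec u\Vdash\langle i+1,\mathfrak a\rangle;(j::\vec v)\Downarrow\mathbf a$. 5. If for all $j:J$, $\vec u\cdot j\Vdash\mathfrak a(j)\Downarrow\mathbf a(j)$, then $\vec u\Vdash\langle 0,\mathfrak a\rangle;[\,]\Downarrow\mathsf{bite}(\mathbf a)$. 6. If for all $j:J$, $\vec u\cdot j\Vdash\langle i,\mathfrak a\rangle;[\,]\Downarrow\mathbf a(j)$, then $\vec u\Vdash\langle i+1,\mathfrak a\rangle;[\,]\Downarrow\mathsf{bite}(\mathbf a)$. -}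

module Defs where

open import Data.List.Base using (List; []; _∷_; _∷ʳ_)
open import Data.Nat.Base using (ℕ; zero; suc)
open import Data.Product.Base using (Σ-syntax; _×_)
open import Level using (Level; _⊔_)
open import Relation.Binary.PropositionalEquality.Core using (_≡_)

private
  variable
    i j a b p : Level

data 𝓔 (I : Set i) (J : Set j) (A : Set a) : Set (i ⊔ j ⊔ a) where
  ret   : A → 𝓔 I J A
  query : I → (J → 𝓔 I J A) → 𝓔 I J A

data 𝓑 (J : Set j) (A : Set a) : Set (j ⊔ a) where
  spit : A → 𝓑 J A
  bite : (J → 𝓑 J A) → 𝓑 J A

infix 4 _⊩_⇓_ _⊩⟨_∣_⟩⨾_⇓_

data _⊩_⇓_ {J : Set j} {A : Set a} :
  List J → 𝓔 ℕ J A → 𝓑 J A → Set (j ⊔ a)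

-- u ⊩⟨ n ∣ 𝔞 ⟩⨾ v ⇓ 𝐚 : v is the part of u still to be traversed in
-- order to reach the answer to the pending query n with continuation 𝔞.
data _⊩⟨_∣_⟩⨾_⇓_ {J : Set j} {A : Set a} :
  List J → ℕ → (J → 𝓔 ℕ J A) → List J → 𝓑 J A → Set (j ⊔ a)

data _⊩_⇓_ {J = J} {A = A} where
  ⇓-ret : ∀ {u : List J} {x : A} →
    u ⊩ ret x ⇓ spit x
  ⇓-query : ∀ {u : List J} {n : ℕ} {𝔞 : J → 𝓔 ℕ J A} {𝐚 : 𝓑 J A} →
    u ⊩⟨ n ∣ 𝔞 ⟩⨾ u ⇓ 𝐚 →
    u ⊩ query n 𝔞 ⇓ 𝐚

data _⊩⟨_∣_⟩⨾_⇓_ {J = J} {A = A} where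
  ⇓-zero-∷ : ∀ {u v : List J} {x : J} {𝔞 : J → 𝓔 ℕ J A} {𝐚 : 𝓑 J A} →
    u ⊩ 𝔞 x ⇓ 𝐚 →
    u ⊩⟨ zero ∣ 𝔞 ⟩⨾ (x ∷ v) ⇓ 𝐚
  ⇓-suc-∷ : ∀ {u v : List J} {n : ℕ} {x : J} {𝔞 : J → 𝓔 ℕ J A} {𝐚 : 𝓑 J A} →
    u ⊩⟨ n ∣ 𝔞 ⟩⨾ v ⇓ 𝐚 →
    u ⊩⟨ suc n ∣ 𝔞 ⟩⨾ (x ∷ v) ⇓ 𝐚
  ⇓-zero-[] : ∀ {u : List J} {𝔞 : J → 𝓔 ℕ J A} {𝐚 : J → 𝓑 J A} →
    (∀ x → (u ∷ʳ x) ⊩ 𝔞 x ⇓ 𝐚 x) →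
    u ⊩⟨ zero ∣ 𝔞 ⟩⨾ [] ⇓ bite 𝐚
  ⇓-suc-[] : ∀ {u : List J} {n : ℕ} {𝔞 : J → 𝓔 ℕ J A} {𝐚 : J → 𝓑 J A} →
    (∀ x → (u ∷ʳ x) ⊩⟨ n ∣ 𝔞 ⟩⨾ [] ⇓ 𝐚 x) →
    u ⊩⟨ suc n ∣ 𝔞 ⟩⨾ [] ⇓ bite 𝐚

-- f is defined by structural recursion on its dialogue argument, the
-- parameter in P being allowed to vary in recursive calls.  The query
-- clause q sees the subtrees only through the recursive calls on them: were
-- it given the subtrees themselves, every f would satisfy this trivially.
StructurallyRecursive : {P : Set p} {I : Set i} {J : Set j} {A : Set a}
  {B : Set b} → (P → 𝓔 I J A → B) → Set (p ⊔ i ⊔ j ⊔ a ⊔ b)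
StructurallyRecursive {P = P} {I = I} {J = J} {A = A} {B = B} f =
  Σ[ r ∈ (P → A → B) ]
  Σ[ q ∈ (P → I → (J → P → B) → B) ]
    (∀ u x → f u (ret x) ≡ r u x) ×
    (∀ u n 𝔞 → f u (query n 𝔞) ≡ q u n (λ x v → f v (𝔞 x)))

{-# OPTIONS --safe #-}
module Submission where

open import Defs
open import Data.List.Base using (List; []; _∷_; _∷ʳ_)
open import Data.Nat.Base using (ℕ; zero; suc)
open import Data.Product.Base using (Σ-syntax; _×_; _,_)
open import Level using (Level)
open import Relation.Binary.PropositionalEquality.Core using (refl)

-- The list `u` holds the answers bitten off so far, the entry at position n answering query n. A
-- query beyond its end bites until that position is filled. The relation has exactly one rule per
-- case of this procedure, so it follows by the same recursion.

private
  variable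
    j a : Level
    J : Set j
    A : Set a

-- The continuation k stands for the already normalized subtrees, so that
-- the recursion on n and v is separate from the one on dialogues.
normQuery : (J → List J → 𝓑 J A) → List J → ℕ → List J → 𝓑 J A
normQuery k u zero    (x ∷ v) = k x u
normQuery k u (suc n) (x ∷ v) = normQuery k u n v
normQuery k u zero    []      = bite λ x → k x (u ∷ʳ x)
-- The new answer fills the position being skipped, so nothing is left to traverse: `u` grows, `[]`
-- stays.
normQuery k u (suc n) []      = bite λ x → normQuery k (u ∷ʳ x) n []

normalize : List J → 𝓔 ℕ J A → 𝓑 J A
normalize u (ret x)     = spit x
normalize u (query n 𝔞) = normQuery (λ x v → normalize v (𝔞 x)) u n u

-- The hypothesis on `k` ranges over all lists because bites extend `u` before a subtree is reached.
normQuery-⇓ : {𝔞 : J → 𝓔 ℕ J A} {k : J → List J → 𝓑 J A} →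
  (∀ x u → u ⊩ 𝔞 x ⇓ k x u) →
  ∀ u n v → u ⊩⟨ n ∣ 𝔞 ⟩⨾ v ⇓ normQuery k u n v
normQuery-⇓ h u zero    (x ∷ v) = ⇓-zero-∷ (h x u)
normQuery-⇓ h u (suc n) (x ∷ v) = ⇓-suc-∷ (normQuery-⇓ h u n v)
normQuery-⇓ h u zero    []      = ⇓-zero-[] λ x → h x (u ∷ʳ x)
normQuery-⇓ h u (suc n) []      = ⇓-suc-[] λ x → normQuery-⇓ h (u ∷ʳ x) n []

normalize-⇓ : (u : List J) (𝔞 : 𝓔 ℕ J A) → u ⊩ 𝔞 ⇓ normalize u 𝔞
normalize-⇓ u (ret x)     = ⇓-ret
normalize-⇓ u (query n 𝔞) =
  ⇓-query (normQuery-⇓ (λ x v → normalize-⇓ v (𝔞 x)) u n u)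

corollary3p3 : {j a : Level} (J : Set j) (A : Set a) →
    Σ[ norm ∈ (List J → 𝓔 ℕ J A → 𝓑 J A) ]
    StructurallyRecursive norm ×
    (∀ (u : List J) (𝔞 : 𝓔 ℕ J A) → u ⊩ 𝔞 ⇓ norm u 𝔞)
corollary3p3 J A =
  normalize ,
  ( (λ _ → spit)
  -- Subtrees enter only through `k`, so both equations are definitional.
  , (λ u n k → normQuery k u n u)
  , (λ _ _ → refl)
  , (λ _ _ _ → refl)) ,
  normalize-⇓
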